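{- Let $L$ be a (classical first-order) signature and let $\varphi$ be a first-order $L$-formula. Then $\varphi$ is bipreserved under reduced products if and only if it is equivalent to a Palyutin formula.
   Context: Classical first-order logic with equality; structures are nonempty. All filters are proper filters on (nonempty) sets. Reduced products: for a family $(M_i)_{i\in I}$ of $L$-structures and a filter $F$ on $I$, let $a\sim_F b$ on $\prod_i M_i$ iff $\{i : a_i=b_i\}\in F$. The reduced product $\prod_i M_i/F$ has domain $\prod_i M_i/\sim_F$; a relation $R$ holds of the class of $(a_i)_i$ iff $\{i : M_i\models R(a_i)\}\in F$, and functions (and constants) are interpreted coordinatewise. A theory $T$ is preserved under reduced products if for every family $(M_i)_{i\in I}$ and filter $F$ on $I$ with $\{i: M_i\models T\}\in F$ we have $\prod_i M_i/F\models T$; it is copreserved under reduced products if for every family $(M_i)_{i\in I}$ and filter $F$ on $I$ with $\prod_i M_i/F\models T$ we have $\{i : M_i\models T\}\in F$. A formula $\varphi(x)$ is preserved (resp. copreserved) under reduced products if the $L(x)$-theory $\{\varphi(x)\}$ is, where $L(x)$ is $L$ with the variables $x$ added as new constant symbols. Bipreserved means both preserved and copreserved. Palyutin formulas: the smallest set of first-order formulas such that (1) it contains $\top$, $\bot$ and all atomic formulas; (2) it is closed under conjunction, $\exists$ and $\forall$; (3) if $\varphi,\psi$ are Palyutin formulas and $x$ is any variable, then $(\exists x\,\varphi) \wedge \forall x\,(\varphi \rightarrow \psi)$ is a Palyutin formula. -}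

module Defs where

open import Level using (Level; suc)
open import Data.Nat.Base as ℕ using (ℕ; _+_)
open import Data.Fin.Base as Fin using (Fin; splitAt)
open import Data.Vec.Functional using (Vector; _∷_; [])
open import Data.Sum.Base using (_⊎_; inj₁; inj₂; [_,_]′)
open import Data.Product.Base using (_×_; _,_; Σ-syntax)
open import Data.Unit.Polymorphic.Base using (⊤)
open import Data.Empty.Polymorphic using (⊥)
open import Function.Base using (const)
open import Function.Bundles using (_⇔_)
open import Relation.Nullary.Negation.Core using (¬_)
open import Relation.Unary using (Pred; _∈_; _⊆_; _∩_; ｛_｝)
open import Relation.Binary.Bundles using (Setoid)

private
  variable
    ℓ : Level

-- Throughout, "set" means a type in `Set ℓ`, for a fixed but arbitrary ℓ.
--
-- The definitions below have their intended classical meaning in the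
-- presence of `ExcludedMiddle` and `Extensionality`. As `ExcludedMiddle`
-- decides arbitrary types, not only propositions, the two together also
-- give the axiom of choice, including a choice of representatives for
-- equivalence classes.

------------------------------------------------------------------------
-- Syntax

-- Constant symbols are the function symbols of arity 0.

record Signature (ℓ : Level) : Set (suc ℓ) where
  field
    Func  : Set ℓ
    Rel   : Set ℓ
    arity : Func → ℕ
    arityᴿ : Rel → ℕ

open Signature public

-- `Term L n` and `Formula L n` have their free variables among
-- x₀ , … , xₙ₋₁ (de Bruijn indices; a quantifier binds index 0).

data Term (L : Signature ℓ) (n : ℕ) : Set ℓ where
  var  : Fin n → Term L n
  func : (f : Func L) → Vector (Term L n) (arity L f) → Term L n

infix  8 _≐_
infixr 7 _∧′_
infixr 6 _∨′_
infixr 5 _⇒′_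

data Formula (L : Signature ℓ) (n : ℕ) : Set ℓ where
  ⊤′ ⊥′          : Formula L n
  _≐_            : Term L n → Term L n → Formula L n
  rel            : (R : Rel L) → Vector (Term L n) (arityᴿ L R) → Formula L n
  _∧′_ _∨′_ _⇒′_ : Formula L n → Formula L n → Formula L n
  ∃′ ∀′          : Formula L (ℕ.suc n) → Formula L n

Sentence : Signature ℓ → Set ℓ
Sentence L = Formula L 0

Theory : Signature ℓ → Set (suc ℓ)
Theory {ℓ} L = Pred (Sentence L) ℓ

data Palyutin {L : Signature ℓ} : {n : ℕ} → Formula L n → Set ℓ where
  ⊤-pal   : ∀ {n} → Palyutin {n = n} ⊤′
  ⊥-pal   : ∀ {n} → Palyutin {n = n} ⊥′
  ≐-pal   : ∀ {n} (s t : Term L n) → Palyutin (s ≐ t)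
  rel-pal : ∀ {n} (R : Rel L) (ts : Vector (Term L n) (arityᴿ L R)) →
            Palyutin (rel R ts)
  ∧-pal   : ∀ {n} {φ ψ : Formula L n} →
            Palyutin φ → Palyutin ψ → Palyutin (φ ∧′ ψ)
  ∃-pal   : ∀ {n} {φ : Formula L (ℕ.suc n)} → Palyutin φ → Palyutin (∃′ φ)
  ∀-pal   : ∀ {n} {φ : Formula L (ℕ.suc n)} → Palyutin φ → Palyutin (∀′ φ)
  ∃∀-pal  : ∀ {n} {φ ψ : Formula L (ℕ.suc n)} → Palyutin φ → Palyutin ψ →
            Palyutin (∃′ φ ∧′ ∀′ (φ ⇒′ ψ))

------------------------------------------------------------------------
-- Semantics

-- Quotients are not available, so the domain is a setoid, whose
-- equivalence relation plays the role of equality (and interprets _≐_).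
-- The field `point` says that the domain is nonempty.

record Structure (L : Signature ℓ) : Set (suc ℓ) where
  field
    domain : Setoid ℓ ℓ

  open Setoid domain public

  field
    point     : Carrier
    ⟦_⟧ᶠ      : (f : Func L) → Vector Carrier (arity L f) → Carrier
    ⟦⟧ᶠ-cong  : ∀ f {as bs} → (∀ j → as j ≈ bs j) → ⟦ f ⟧ᶠ as ≈ ⟦ f ⟧ᶠ bs
    ⟦_⟧ᴿ      : (R : Rel L) → Vector Carrier (arityᴿ L R) → Set ℓ
    ⟦⟧ᴿ-resp  : ∀ R {as bs} → (∀ j → as j ≈ bs j) → ⟦ R ⟧ᴿ as → ⟦ R ⟧ᴿ bs

∣_∣ : {L : Signature ℓ} → Structure L → Set ℓ
∣ M ∣ = Structure.Carrier M

eval : {L : Signature ℓ} (M : Structure L) {n : ℕ} →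
       Vector ∣ M ∣ n → Term L n → ∣ M ∣
eval M v (var i)     = v i
eval M v (func f ts) = Structure.⟦_⟧ᶠ M f (λ j → eval M v (ts j))

infix 4 _⊨_[_] _⊨_ _⊨ᵀ_

_⊨_[_] : {L : Signature ℓ} (M : Structure L) {n : ℕ} →
         Formula L n → Vector ∣ M ∣ n → Set ℓ
M ⊨ ⊤′       [ v ] = ⊤
M ⊨ ⊥′       [ v ] = ⊥
M ⊨ s ≐ t    [ v ] = Structure._≈_ M (eval M v s) (eval M v t)
M ⊨ rel R ts [ v ] = Structure.⟦_⟧ᴿ M R (λ j → eval M v (ts j))
M ⊨ φ ∧′ ψ   [ v ] = M ⊨ φ [ v ] × M ⊨ ψ [ v ]
M ⊨ φ ∨′ ψ   [ v ] = M ⊨ φ [ v ] ⊎ M ⊨ ψ [ v ]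
M ⊨ φ ⇒′ ψ   [ v ] = M ⊨ φ [ v ] → M ⊨ ψ [ v ]
M ⊨ ∃′ φ     [ v ] = Σ[ a ∈ ∣ M ∣ ] M ⊨ φ [ a ∷ v ]
M ⊨ ∀′ φ     [ v ] = (a : ∣ M ∣) → M ⊨ φ [ a ∷ v ]

_⊨_ : {L : Signature ℓ} → Structure L → Sentence L → Set ℓ
M ⊨ φ = M ⊨ φ [ [] ]

_⊨ᵀ_ : {L : Signature ℓ} → Structure L → Theory L → Set ℓ
M ⊨ᵀ T = ∀ φ → φ ∈ T → M ⊨ φ

Equivalent : {L : Signature ℓ} {n : ℕ} → Formula L n → Formula L n → Set (suc ℓ)
Equivalent {L = L} {n} φ ψ =
  (M : Structure L) (v : Vector ∣ M ∣ n) → M ⊨ φ [ v ] ⇔ M ⊨ ψ [ v ]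

------------------------------------------------------------------------
-- Reduced products

-- Proper filters. The index set is then nonempty: otherwise the whole
-- set would be the empty set.

record Filter (I : Set ℓ) : Set (suc ℓ) where
  field
    sets   : Pred (Pred I ℓ) ℓ
    whole  : (λ _ → ⊤) ∈ sets
    upward : ∀ {P Q : Pred I ℓ} → P ⊆ Q → P ∈ sets → Q ∈ sets
    meet   : ∀ {P Q : Pred I ℓ} → P ∈ sets → Q ∈ sets → (P ∩ Q) ∈ sets
    proper : ¬ ((λ _ → ⊥) ∈ sets)

  meets : ∀ {n} {P : Fin n → Pred I ℓ} →
          (∀ j → P j ∈ sets) → (λ i → ∀ j → P j i) ∈ sets
  meets {ℕ.zero}  h = upward (λ _ ()) whole
  meets {ℕ.suc n} h =
    upward (λ { (p , q) Fin.zero → p ; (p , q) (Fin.suc j) → q j })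
           (meet (h Fin.zero) (meets (λ j → h (Fin.suc j))))

module _ {L : Signature ℓ} where

  reducedProduct : {I : Set ℓ} → (I → Structure L) → Filter I → Structure L
  reducedProduct {I} M F = record
    { domain = record
      { Carrier       = ∀ i → ∣ M i ∣
      ; _≈_           = λ a b → (λ i → M.E i (a i) (b i)) ∈ sets
      ; isEquivalence = record
        { refl  = upward (λ {i} _ → M.refl i) whole
        ; sym   = upward (λ {i} → M.sym i)
        ; trans = λ p q → upward (λ {i} (r , s) → M.trans i r s) (meet p q)
        }
      }
    ; point    = λ i → M.point i
    ; ⟦_⟧ᶠ     = λ f as i → M.⟦_⟧ᶠ i f (λ j → as j i)
    ; ⟦⟧ᶠ-cong = λ f as≈bs → upward (λ {i} → M.⟦⟧ᶠ-cong i f) (meets as≈bs)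
    ; ⟦_⟧ᴿ     = λ R as → (λ i → M.⟦_⟧ᴿ i R (λ j → as j i)) ∈ sets
    ; ⟦⟧ᴿ-resp = λ R as≈bs r →
        upward (λ {i} (e , s) → M.⟦⟧ᴿ-resp i R e s) (meet (meets as≈bs) r)
    }
    where
    open Filter F
    module M (i : I) where
      open Structure (M i) public renaming (_≈_ to E)

  Preserved : Theory L → Set (suc ℓ)
  Preserved T = (I : Set ℓ) (M : I → Structure L) (F : Filter I) →
    (λ i → M i ⊨ᵀ T) ∈ Filter.sets F → reducedProduct M F ⊨ᵀ T

  Copreserved : Theory L → Set (suc ℓ)
  Copreserved T = (I : Set ℓ) (M : I → Structure L) (F : Filter I) →
    reducedProduct M F ⊨ᵀ T → (λ i → M i ⊨ᵀ T) ∈ Filter.sets F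

------------------------------------------------------------------------
-- Formulas as sentences with new constants

-- `L ⟨ n ⟩` is L(x) for x = (x₀ , … , xₙ₋₁).

_⟨_⟩ : Signature ℓ → ℕ → Signature ℓ
L ⟨ n ⟩ = record
  { Func   = Func L ⊎ Fin n
  ; Rel    = Rel L
  ; arity  = [ arity L , const 0 ]′
  ; arityᴿ = arityᴿ L
  }

-- Under k binders, indices below k are bound and the remaining n are the
-- free variables, which become the new constants.

nameᵗ : {L : Signature ℓ} {n : ℕ} (k : ℕ) → Term L (k + n) → Term (L ⟨ n ⟩) k
nameᵗ k (var i)     = [ var , (λ x → func (inj₂ x) []) ]′ (splitAt k i)
nameᵗ k (func f ts) = func (inj₁ f) (λ j → nameᵗ k (ts j))

name : {L : Signature ℓ} {n : ℕ} (k : ℕ) → Formula L (k + n) → Formula (L ⟨ n ⟩) k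
name k ⊤′         = ⊤′
name k ⊥′         = ⊥′
name k (s ≐ t)    = nameᵗ k s ≐ nameᵗ k t
name k (rel R ts) = rel R (λ j → nameᵗ k (ts j))
name k (φ ∧′ ψ)   = name k φ ∧′ name k ψ
name k (φ ∨′ ψ)   = name k φ ∨′ name k ψ
name k (φ ⇒′ ψ)   = name k φ ⇒′ name k ψ
name k (∃′ φ)     = ∃′ (name (ℕ.suc k) φ)
name k (∀′ φ)     = ∀′ (name (ℕ.suc k) φ)

asTheory : {L : Signature ℓ} {n : ℕ} → Formula L n → Theory (L ⟨ n ⟩)
asTheory φ = ｛ name 0 φ ｝

Bipreserved : {L : Signature ℓ} {n : ℕ} → Formula L n → Set (suc ℓ)
Bipreserved φ = Preserved (asTheory φ) × Copreserved (asTheory φ)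

{-# OPTIONS --safe #-}

-- Palyutin formulas satisfy the analogue of Łoś's theorem for every filter.
-- Conversely, in the powers M^ω modulo the Fréchet filter, finitely many
-- infinite sets have disjoint infinite subsets, so elements can be glued:
-- if each of ¬q₁ , … , ¬qₖ is separately consistent with p, they are
-- so jointly. By a back-and-forth argument, the truth of any φ in such powers
-- is determined by the truth of finitely many Palyutin formulas; if φ is
-- bipreserved, this holds in M itself. The truth values realised by those
-- formulas are closed under meets (direct products), and those where φ holds
-- form a filter in this finite semilattice. So φ is equivalent to the
-- conjunction of those of the formulas that it implies, or to ⊥.
module Submission where

open import Defs
open import Level using (Level; Lift; lift; lower)
open import Data.Nat.Base as ℕ using (ℕ; zero; suc; _≤_; _<_; _*_)
open import Data.Nat.Properties as ℕₚ
  using (≤-refl; ≤-trans; m≤m+n; m≤n+m; m≤m*n; <-cmp; <-irrefl; m≤n⇒m<n∨m≡n)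
open import Data.Nat.DivMod using (_mod_; [m+kn]%n≡m%n; m<n⇒m%n≡m; m%n<n)
open import Data.Fin.Base as Fin using (Fin; toℕ; splitAt)
open import Data.Fin.Properties using (toℕ<n; toℕ-injective; toℕ-fromℕ<)
open import Data.Vec.Functional using (Vector; _∷_; []; _++_)
open import Data.List.Base as List using (List; filter; lookup)
open import Data.List.Membership.Propositional renaming (_∈_ to _∈ᴸ_)
open import Data.List.Membership.Propositional.Properties
  using (∈-++⁺ˡ; ∈-++⁺ʳ; ∈-map⁺; ∈-filter⁺; ∈-cartesianProductWith⁺)
open import Data.List.Relation.Unary.All as All using (All)
open import Data.List.Relation.Unary.All.Properties using (all-filter)
open import Data.List.Relation.Unary.Any using (here; there; index)
open import Data.List.Relation.Unary.Any.Properties using (lookup-index)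
open import Data.Maybe.Base using (just; nothing; maybe′)
open import Data.Product.Base using (∃; ∃-syntax; Σ-syntax; _×_; _,_; proj₁; proj₂)
open import Data.Sum.Base using (_⊎_; inj₁; inj₂)
open import Data.Unit.Polymorphic.Base using (⊤; tt)
open import Data.Empty using (⊥-elim)
open import Function.Base using (_∘_; id)
open import Function.Bundles using (_⇔_; mk⇔; Equivalence)
import Function.Properties.Equivalence as ⇔
open import Relation.Nullary using (Dec; yes; no; ¬_)
open import Relation.Nullary.Decidable using (decidable-stable)
open import Relation.Unary using (Pred; _∈_)
open import Relation.Binary.Bundles using (Setoid)
open import Relation.Binary.Definitions using (tri<; tri≈; tri>)
open import Relation.Binary.PropositionalEquality
  using (_≡_; refl; sym; trans; cong; cong₂; subst)
open import Axiom.ExcludedMiddle using (ExcludedMiddle)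
open import Axiom.Extensionality.Propositional using (Extensionality)

open Equivalence using (to; from)

private
  variable
    a b ℓ : Level
    n : ℕ

-- Preliminaries on lists, filters and infinite sets

≡⇒⇔ : {A B : Set a} → A ≡ B → A ⇔ B
≡⇒⇔ refl = mk⇔ id id

sublists : {A : Set a} → List A → List (List A)
sublists List.[]       = List.[] List.∷ List.[]
sublists (x List.∷ xs) = sublists xs List.++ List.map (x List.∷_) (sublists xs)

-- Its only member is the whole index set, so a reduced product modulo it is the direct product. The
-- index `i₀` makes it proper.
trivialFilter : {I : Set ℓ} → I → Filter I
trivialFilter i₀ = record
  { sets   = λ P → ∀ i → P i
  ; whole  = λ _ → tt
  ; upward = λ P⊆Q h i → P⊆Q (h i)
  ; meet   = λ p q i → p i , q i
  ; proper = λ h → lower (h i₀)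
  }

fréchet : Filter (Lift ℓ ℕ)
fréchet = record
  { sets   = λ P → Σ[ N ∈ ℕ ] (∀ m → N ≤ m → P (lift m))
  ; whole  = 0 , λ _ _ → tt
  ; upward = λ P⊆Q (N , h) → N , λ m N≤m → P⊆Q (h m N≤m)
  ; meet   = λ (N , h) (K , k) → N ℕ.+ K , λ m le →
      h m (≤-trans (m≤m+n N K) le) , k m (≤-trans (m≤n+m K N) le)
  ; proper = λ (N , h) → lower (h N ≤-refl)
  }

Infinite : Pred ℕ ℓ → Set ℓ
Infinite S = ∀ N → Σ[ m ∈ ℕ ] N ≤ m × S m

-- Interpretations, Palyutin types, powers and products

module _ {L : Signature ℓ} where

  Interp : ℕ → Set _
  Interp n = Σ[ M ∈ Structure L ] Vector ∣ M ∣ n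

  infix 4 _⊩_

  _⊩_ : Interp n → Formula L n → Set ℓ
  (M , v) ⊩ φ = M ⊨ φ [ v ]

  -- Bipreservation restated with assignments instead of new constants, the form suited to induction
  -- on formulas.
  Transfers : Formula L n → Set _
  Transfers {n} φ = (I : Set ℓ) (M : I → Structure L) (F : Filter I)
    (v : Vector (∀ i → ∣ M i ∣) n) →
    reducedProduct M F ⊨ φ [ v ] ⇔
    (λ i → M i ⊨ φ [ (λ x → v x i) ]) ∈ Filter.sets F

  Transfers-resp : (φ ψ : Formula L n) → Equivalent φ ψ → Transfers ψ → Transfers φ
  Transfers-resp φ ψ e h I M F v = mk⇔
    (upward (from (e _ _)) ∘ to (h I M F v) ∘ to (e _ _))
    (from (e _ _) ∘ from (h I M F v) ∘ upward (to (e _ _)))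
    where open Filter F

  Pal : ℕ → Set ℓ
  Pal n = ∃ (Palyutin {L = L} {n})

  ⋀ : List (Pal n) → Pal n
  ⋀ List.[]                = ⊤′ , ⊤-pal
  ⋀ ((φ , p) List.∷ ps) = φ ∧′ proj₁ (⋀ ps) , ∧-pal p (proj₂ (⋀ ps))

  ⋀-elim : (X : Interp n) (ps : List (Pal n)) → X ⊩ proj₁ (⋀ ps) →
           ∀ {p} → p ∈ᴸ ps → X ⊩ proj₁ p
  ⋀-elim X (_ List.∷ ps) (h , _)  (here refl) = h
  ⋀-elim X (_ List.∷ ps) (_ , hs) (there p∈)  = ⋀-elim X ps hs p∈

  ⋀-intro : (X : Interp n) (ps : List (Pal n)) →
            All (λ p → X ⊩ proj₁ p) ps → X ⊩ proj₁ (⋀ ps)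
  ⋀-intro X _ All.[]       = tt
  ⋀-intro X _ (h All.∷ hs) = h , ⋀-intro X _ hs

  -- When `⋀ A` is realised, the failure of this formula means that some realisation of `⋀ A`
  -- refutes `q`.
  relativised : List (Pal (suc n)) → Pal (suc n) → Pal n
  relativised A q = _ , ∃∀-pal (proj₂ (⋀ A)) (proj₂ q)

  ⊤ₚ : Pal n
  ⊤ₚ = ⊤′ , ⊤-pal

  -- The query for ⊤ₚ says just that ⋀ A is realised.
  extensionQueries : List (Pal (suc n)) → List (Pal n)
  extensionQueries ps =
    List.cartesianProductWith relativised (sublists ps) (⊤ₚ List.∷ ps)

  infix 4 _~[_]_

  _~[_]_ : Interp n → List (Pal n) → Interp n → Set ℓ
  X ~[ ps ] Y = ∀ {p} → p ∈ᴸ ps → X ⊩ proj₁ p ⇔ Y ⊩ proj₁ p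

  ~-sym : {X Y : Interp n} {ps : List (Pal n)} → X ~[ ps ] Y → Y ~[ ps ] X
  ~-sym h p∈ = ⇔.sym (h p∈)

  infix 9 _^ω

  _^ω : Structure L → Structure L
  M ^ω = reducedProduct (λ _ → M) fréchet

  -- One implication suffices, because agreement on `ps` is symmetric.
  DeterminedByᵒ : Formula L n → List (Pal n) → Set _
  DeterminedByᵒ {n} φ ps =
    (M M′ : Structure L) (v : Vector ∣ M ^ω ∣ n) (v′ : Vector ∣ M′ ^ω ∣ n) →
    (M ^ω , v) ~[ ps ] (M′ ^ω , v′) → M ^ω ⊨ φ [ v ] → M′ ^ω ⊨ φ [ v′ ]

  DeterminedBy : Formula L n → List (Pal n) → Set _
  DeterminedBy {n} φ ps = (X Y : Interp n) → X ~[ ps ] Y → X ⊩ φ → Y ⊩ φ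

  diagonal : Interp n → Interp n
  diagonal (M , v) = M ^ω , λ x _ → v x

  Transfers⇒diagonal : (φ : Formula L n) → Transfers φ → (X : Interp n) →
                       diagonal X ⊩ φ ⇔ X ⊩ φ
  Transfers⇒diagonal φ t (M , v) = mk⇔
    (λ h → let (N , k) = to (t _ _ fréchet _) h in k N ≤-refl)
    (λ h → from (t _ _ fréchet _) (0 , λ _ _ → h))

  ∏ : {I : Set ℓ} → I → (I → Interp n) → Interp n
  ∏ i₀ Z = reducedProduct (proj₁ ∘ Z) (trivialFilter i₀) , λ x i → proj₂ (Z i) x

  Transfers⇒∏ : (φ : Formula L n) → Transfers φ → {I : Set ℓ} (i₀ : I)
                (Z : I → Interp n) → ∏ i₀ Z ⊩ φ ⇔ (∀ i → Z i ⊩ φ)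
  Transfers⇒∏ φ t i₀ Z =
    t _ (proj₁ ∘ Z) (trivialFilter i₀) (λ x i → proj₂ (Z i) x)

  module _ {n : ℕ} where

    reduct : Structure (L ⟨ n ⟩) → Structure L
    reduct M = record
      { domain   = domain
      ; point    = point
      ; ⟦_⟧ᶠ     = λ f → ⟦ inj₁ f ⟧ᶠ
      ; ⟦⟧ᶠ-cong = λ f → ⟦⟧ᶠ-cong (inj₁ f)
      ; ⟦_⟧ᴿ     = ⟦_⟧ᴿ
      ; ⟦⟧ᴿ-resp = ⟦⟧ᴿ-resp
      }
      where open Structure M

    constants : (M : Structure (L ⟨ n ⟩)) → Vector ∣ M ∣ n
    constants M x = Structure.⟦_⟧ᶠ M (inj₂ x) []

    expand : (M : Structure L) → Vector ∣ M ∣ n → Structure (L ⟨ n ⟩)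
    expand M v = record
      { domain   = domain
      ; point    = point
      ; ⟦_⟧ᶠ     = λ { (inj₁ f) as → ⟦ f ⟧ᶠ as ; (inj₂ x) _ → v x }
      ; ⟦⟧ᶠ-cong = λ { (inj₁ f) → ⟦⟧ᶠ-cong f ; (inj₂ x) _ → Setoid.refl domain }
      ; ⟦_⟧ᴿ     = ⟦_⟧ᴿ
      ; ⟦⟧ᴿ-resp = ⟦⟧ᴿ-resp
      }
      where
      open Structure M

-- Classical witnesses and disjoint infinite sets

module Classical
  (em : ∀ a → ExcludedMiddle a) (fe : ∀ a b → Extensionality a b) where

  ext : {A : Set a} {B : A → Set b} {f g : (x : A) → B x} →
        (∀ x → f x ≡ g x) → f ≡ g
  ext = fe _ _

  dec : (A : Set a) → Dec A
  dec A = em _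

  dne : {A : Set a} → ¬ ¬ A → A
  dne = decidable-stable (em _)

  -- A single element testing both ∃ P and ∀ x (P x → Q x).
  testElement : {A : Set a} (P Q : A → Set b) → A →
                ∃[ x ] (∀ y → P y → P x) × (Q x → ∀ y → P y → Q y)
  -- First choice is a counterexample to the inclusion of `P` in `Q`, then any member of `P`, then
  -- the default `d`, for which both claims are vacuous.
  testElement P Q d with dec (∃[ x ] P x × ¬ Q x)
  ... | yes (x , px , ¬qx) = x , (λ _ _ → px) , λ qx → ⊥-elim (¬qx qx)
  ... | no ∄ with dec (∃ P)
  ...   | yes (x , px) = x , (λ _ _ → px) , λ _ y py → dne λ ¬qy → ∄ (y , py , ¬qy)
  ...   | no ∄P        = d , (λ y py → ⊥-elim (∄P (y , py))) ,
                             λ _ y py → ⊥-elim (∄P (y , py))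

  filter∈sublists : {A : Set a} {P : Pred A b} (P? : ∀ x → Dec (P x)) (xs : List A) →
                    filter P? xs ∈ᴸ sublists xs
  filter∈sublists P? List.[] = here refl
  filter∈sublists P? (x List.∷ xs) with P? x
  ... | yes _ = ∈-++⁺ʳ (sublists xs) (∈-map⁺ _ (filter∈sublists P? xs))
  ... | no  _ = ∈-++⁺ˡ (filter∈sublists P? xs)

  -- Finitely many infinite sets have pairwise disjoint infinite subsets: visit
  -- the sets cyclically, each time choosing an element beyond all earlier ones.
  colouring : ∀ {k} (S : Fin (suc k) → Pred ℕ ℓ) →
    Σ[ c ∈ (ℕ → Fin (suc k)) ]
      (∀ j → Infinite (S j) → Infinite (λ i → S j i × c i ≡ j))
  colouring {k = k} S = c , c-infinite
    where
    pick : (j : Fin (suc k)) (N : ℕ) →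
           Σ[ m ∈ ℕ ] N ≤ m × (Infinite (S j) → S j m)
    pick j N with dec (Infinite (S j))
    ... | yes inf = let (m , N≤m , s) = inf N in m , N≤m , λ _ → s
    -- For a finite `S j` the visit only has to move forward, so `N` itself will do.
    ... | no ¬inf = N , ≤-refl , λ inf → ⊥-elim (¬inf inf)

    turn : ℕ → Fin (suc k)
    turn t = t mod suc k

    visit : ℕ → ℕ
    visit zero    = proj₁ (pick (turn 0) 0)
    visit (suc t) = proj₁ (pick (turn (suc t)) (suc (visit t)))

    visit-∈ : ∀ t → Infinite (S (turn t)) → S (turn t) (visit t)
    visit-∈ zero    = proj₂ (proj₂ (pick (turn 0) 0))
    visit-∈ (suc t) = proj₂ (proj₂ (pick (turn (suc t)) (suc (visit t))))

    visit-suc : ∀ t → visit t < visit (suc t)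
    visit-suc t = proj₁ (proj₂ (pick (turn (suc t)) (suc (visit t))))

    visit-mono : ∀ {s t} → s < t → visit s < visit t
    visit-mono {s} {suc t} (ℕ.s≤s s≤t) with m≤n⇒m<n∨m≡n s≤t
    ... | inj₁ s<t  = ℕₚ.<-trans (visit-mono s<t) (visit-suc t)
    ... | inj₂ refl = visit-suc t

    visit-injective : ∀ {s t} → visit s ≡ visit t → s ≡ t
    visit-injective {s} {t} e with <-cmp s t
    ... | tri< s<t _ _ = ⊥-elim (<-irrefl e (visit-mono s<t))
    ... | tri≈ _ s≡t _ = s≡t
    ... | tri> _ _ t<s = ⊥-elim (<-irrefl (sym e) (visit-mono t<s))

    t≤visit : ∀ t → t ≤ visit t
    t≤visit zero    = ℕ.z≤n
    t≤visit (suc t) = ≤-trans (ℕ.s≤s (t≤visit t)) (visit-suc t)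

    c : ℕ → Fin (suc k)
    c i with dec (Σ[ t ∈ ℕ ] visit t ≡ i)
    ... | yes (t , _) = turn t
    -- Numbers never visited may have any colour.
    ... | no  _       = Fin.zero

    c-visit : ∀ t → c (visit t) ≡ turn t
    c-visit t with dec (Σ[ s ∈ ℕ ] visit s ≡ visit t)
    ... | yes (s , e) = cong turn (visit-injective {s} {t} e)
    ... | no ∄        = ⊥-elim (∄ (t , refl))

    turn-cyclic : ∀ j N → turn (toℕ j ℕ.+ N * suc k) ≡ j
    turn-cyclic j N = toℕ-injective (trans
      (toℕ-fromℕ< (m%n<n (toℕ j ℕ.+ N * suc k) (suc k)))
      (trans ([m+kn]%n≡m%n (toℕ j) N (suc k)) (m<n⇒m%n≡m (toℕ<n j))))

    c-infinite : ∀ j → Infinite (S j) → Infinite (λ i → S j i × c i ≡ j)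
    c-infinite j inf N = visit t , N≤visit , s , trans (c-visit t) turn≡j
      where
      -- A turn of colour `j` that comes no earlier than `N`; visits never lag behind their turn
      -- number, so `visit t` is at least `N`.
      t = toℕ j ℕ.+ N * suc k
      turn≡j = turn-cyclic j N
      N≤visit = ≤-trans (m≤m*n N (suc k)) (≤-trans (m≤n+m _ (toℕ j)) (t≤visit t))
      s = subst (λ j → S j (visit t)) turn≡j
            (visit-∈ t (subst (λ j → Infinite (S j)) (sym turn≡j) inf))

  -- Transfer of Palyutin formulas to reduced products

  module _ {L : Signature ℓ} where

    module _ {I : Set ℓ} (M : I → Structure L) (F : Filter I) where
      open Filter F

      eval-reducedProduct : (v : Vector (∀ i → ∣ M i ∣) n) (t : Term L n) →
        eval (reducedProduct M F) v t ≡ λ i → eval (M i) (λ x → v x i) t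
      eval-reducedProduct v (var x)     = refl
      eval-reducedProduct v (func f ts) =
        cong (Structure.⟦_⟧ᶠ (reducedProduct M F) f)
             (ext λ j → eval-reducedProduct v (ts j))

      slice-∷ : (x : ∀ i → ∣ M i ∣) (v : Vector (∀ i → ∣ M i ∣) n) (i : I) →
                (λ y → (x ∷ v) y i) ≡ x i ∷ λ y → v y i
      slice-∷ x v i = ext λ { Fin.zero → refl ; (Fin.suc y) → refl }

    transfer-∷ : (φ : Formula L (suc n)) → Transfers φ →
      {I : Set ℓ} (M : I → Structure L) (F : Filter I)
      (x : ∀ i → ∣ M i ∣) (v : Vector (∀ i → ∣ M i ∣) n) →
      reducedProduct M F ⊨ φ [ x ∷ v ] ⇔
      (λ i → M i ⊨ φ [ x i ∷ (λ y → v y i) ]) ∈ Filter.sets F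
    transfer-∷ φ t M F x v = mk⇔
      (upward (λ {i} → subst (M i ⊨ φ [_]) (slice-∷ M F x v i)) ∘ to (t _ M F (x ∷ v)))
      (from (t _ M F (x ∷ v)) ∘ upward (λ {i} → subst (M i ⊨ φ [_]) (sym (slice-∷ M F x v i))))
      where open Filter F

    -- Atomic cases hold by the definition of the reduced product. For quantifiers, test elements
    -- chosen in each coordinate form a single element of the product that decides the quantified
    -- statement at every index.
    Palyutin⇒Transfers : {φ : Formula L n} → Palyutin φ → Transfers φ
    Palyutin⇒Transfers ⊤-pal I M F v = mk⇔ (λ _ → Filter.whole F) (λ _ → tt)
    Palyutin⇒Transfers ⊥-pal I M F v =
      mk⇔ (λ ()) (λ h → ⊥-elim (Filter.proper F h))
    Palyutin⇒Transfers (≐-pal s t) I M F v = ≡⇒⇔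
      (cong₂ (Structure._≈_ (reducedProduct M F))
             (eval-reducedProduct M F v s) (eval-reducedProduct M F v t))
    Palyutin⇒Transfers (rel-pal R ts) I M F v = ≡⇒⇔
      (cong (Structure.⟦_⟧ᴿ (reducedProduct M F) R)
            (ext λ j → eval-reducedProduct M F v (ts j)))
    Palyutin⇒Transfers (∧-pal p q) I M F v = mk⇔
      (λ (h , k) → meet (to p′ h) (to q′ k))
      (λ h → from p′ (upward proj₁ h) , from q′ (upward proj₂ h))
      where
      open Filter F
      p′ = Palyutin⇒Transfers p I M F v
      q′ = Palyutin⇒Transfers q I M F v
    Palyutin⇒Transfers (∃-pal {φ = φ} p) I M F v = mk⇔
      (λ (x , h) → upward (x _ ,_) (to (p′ x v) h))
      (λ h → (λ i → proj₁ (ε i)) ,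
             from (p′ _ v) (upward (λ {i} (x , k) → proj₁ (proj₂ (ε i)) x k) h))
      where
      open Filter F
      p′ = transfer-∷ φ (Palyutin⇒Transfers p) M F
      ε : ∀ i → _
      ε i = testElement (λ x → M i ⊨ φ [ x ∷ (λ y → v y i) ]) (λ _ → ⊤)
                        (Structure.point (M i))
    Palyutin⇒Transfers (∀-pal {φ = φ} p) I M F v = mk⇔
      (λ h → upward (λ {i} k x → proj₂ (proj₂ (ε i)) k x tt)
                    (to (p′ _ v) (h (λ i → proj₁ (ε i)))))
      (λ h x → from (p′ x v) (upward (λ k → k (x _)) h))
      where
      open Filter F
      p′ = transfer-∷ φ (Palyutin⇒Transfers p) M F
      ε : ∀ i → _
      ε i = testElement (λ _ → ⊤) (λ x → M i ⊨ φ [ x ∷ (λ y → v y i) ])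
                        (Structure.point (M i))
    Palyutin⇒Transfers (∃∀-pal {φ = φ} {ψ} p q) I M F v = mk⇔
      (λ ((x , h) , k) →
        -- The realisation `x` puts the test element into `φ` on a set of the filter, so that `k`
        -- applies to it. This is the purpose of the existential conjunct.
        let pε = upward (λ {i} → proj₁ (proj₂ (ε i)) (x i)) (to (p′ x v) h)
            qε = to (q′ _ v) (k _ (from (p′ _ v) pε))
        in  meet (upward (_ ,_) pε) (upward (λ {i} → proj₂ (proj₂ (ε i))) qε))
      (λ h →
        (_ , from (p′ _ v)
               (upward (λ {i} ((x , k) , _) → proj₁ (proj₂ (ε i)) x k) h)) ,
        λ x k → from (q′ x v)
          (upward (λ ((_ , f) , px) → f (x _) px) (meet h (to (p′ x v) k))))
      where
      open Filter F
      p′ = transfer-∷ φ (Palyutin⇒Transfers p) M F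
      q′ = transfer-∷ ψ (Palyutin⇒Transfers q) M F
      ε : ∀ i → _
      ε i = testElement (λ x → M i ⊨ φ [ x ∷ (λ y → v y i) ])
                        (λ x → M i ⊨ ψ [ x ∷ (λ y → v y i) ])
                        (Structure.point (M i))

    -- Back-and-forth between Fréchet powers

    forth : (ps : List (Pal {L = L} (suc n))) (M M′ : Structure L)
      (v : Vector ∣ M ^ω ∣ n) (v′ : Vector ∣ M′ ^ω ∣ n) →
      (M ^ω , v) ~[ extensionQueries ps ] (M′ ^ω , v′) →
      (x : ∣ M ^ω ∣) → Σ[ y ∈ ∣ M′ ^ω ∣ ] (M ^ω , x ∷ v) ~[ ps ] (M′ ^ω , y ∷ v′)
    forth {n} ps M M′ v v′ v~v′ x = y , x~y
      where
      true? : (p : Pal (suc n)) → Dec (M ^ω ⊨ proj₁ p [ x ∷ v ])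
      true? p = dec _

      -- The formulas of `ps` true at `x`; the answer `y` has to satisfy these and refute the
      -- others.
      A : List (Pal (suc n))
      A = filter true? ps

      φᴬ : Formula L (suc n)
      φᴬ = proj₁ (⋀ A)

      x⊩A : M ^ω ⊨ φᴬ [ x ∷ v ]
      x⊩A = ⋀-intro (M ^ω , x ∷ v) A (all-filter true? ps)

      query : ∀ {q} → q ∈ᴸ (⊤ₚ List.∷ ps) →
        M ^ω ⊨ proj₁ (relativised A q) [ v ] ⇔ M′ ^ω ⊨ proj₁ (relativised A q) [ v′ ]
      query q∈ = v~v′ (∈-cartesianProductWith⁺ relativised (filter∈sublists true? ps) q∈)

      A-realised : Σ[ z ∈ ∣ M′ ^ω ∣ ] M′ ^ω ⊨ φᴬ [ z ∷ v′ ]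
      A-realised = proj₁ (to (query (here refl)) ((x , x⊩A) , λ _ _ → tt))

      -- The leading `⊤ₚ` keeps the index set nonempty, as `colouring` requires.
      nth : Fin (suc (List.length ps)) → Pal (suc n)
      nth = lookup (⊤ₚ List.∷ ps)

      ε : ∀ j → _
      ε j = testElement (λ z → M′ ^ω ⊨ φᴬ [ z ∷ v′ ])
                        (λ z → M′ ^ω ⊨ proj₁ (nth j) [ z ∷ v′ ])
                        (proj₁ A-realised)

      wit : Fin (suc (List.length ps)) → ∣ M′ ^ω ∣
      wit j = proj₁ (ε j)

      wit⊩A : ∀ j → M′ ^ω ⊨ φᴬ [ wit j ∷ v′ ]
      wit⊩A j = proj₁ (proj₂ (ε j)) (proj₁ A-realised) (proj₂ A-realised)

      -- If `wit j` satisfied its formula, so would every realisation of `A` in `M′ ^ω`. The query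
      -- carries this back to `M ^ω`, where `x` realises `A`.
      wit-refutes : ∀ j → nth j ∈ᴸ (⊤ₚ List.∷ ps) → ¬ M ^ω ⊨ proj₁ (nth j) [ x ∷ v ] →
                  ¬ M′ ^ω ⊨ proj₁ (nth j) [ wit j ∷ v′ ]
      wit-refutes j j∈ ¬px pz =
        ¬px (proj₂ (from (query j∈) (A-realised , proj₂ (proj₂ (ε j)) pz)) x x⊩A)

      at : Lift ℓ ℕ → Vector ∣ M′ ∣ n
      at i y = v′ y i

      S : Fin (suc (List.length ps)) → Pred ℕ ℓ
      S j i = ¬ M′ ⊨ proj₁ (nth j) [ wit j (lift i) ∷ at (lift i) ]

      c   = proj₁ (colouring S)
      c-∞ = proj₂ (colouring S)

      -- The gluing: each coordinate follows the witness given by its colour.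
      y : ∣ M′ ^ω ∣
      y (lift i) = wit (c i) (lift i)

      transfer : (p : Pal (suc n)) (z : ∣ M′ ^ω ∣) →
        M′ ^ω ⊨ proj₁ p [ z ∷ v′ ] ⇔
        (λ i → M′ ⊨ proj₁ p [ z i ∷ at i ]) ∈ Filter.sets fréchet
      transfer p z = transfer-∷ (proj₁ p) (Palyutin⇒Transfers (proj₂ p)) (λ _ → M′) fréchet z v′

      -- At almost all coordinates the finitely many witnesses satisfy `A` simultaneously, so any
      -- mixture of them does too.
      y⊩A : M′ ^ω ⊨ φᴬ [ y ∷ v′ ]
      y⊩A = from (transfer (⋀ A) y)
        (Filter.upward (fréchet {ℓ})
          {P = λ i → ∀ j → M′ ⊨ φᴬ [ wit j i ∷ at i ]}
          (λ {i} h → h (c (lower i)))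
          (Filter.meets (fréchet {ℓ}) λ j → to (transfer (⋀ A) (wit j)) (wit⊩A j)))

      S-infinite : ∀ j → ¬ M′ ^ω ⊨ proj₁ (nth j) [ wit j ∷ v′ ] → Infinite (S j)
      S-infinite j ¬h N = dne λ ∄ → ¬h (from (transfer (nth j) (wit j))
        (N , λ m N≤m → dne λ ¬k → ∄ (m , N≤m , ¬k)))

      -- Refutation modulo the Fréchet filter means failure at infinitely many coordinates. By the
      -- colouring, `y` agrees with `wit j` at infinitely many coordinates of `S j`, so its failures
      -- are not lost.
      y-refutes : ∀ j → nth j ∈ᴸ (⊤ₚ List.∷ ps) → ¬ M ^ω ⊨ proj₁ (nth j) [ x ∷ v ] →
                  ¬ M′ ^ω ⊨ proj₁ (nth j) [ y ∷ v′ ]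
      y-refutes j j∈ ¬px py with to (transfer (nth j) y) py
      ... | N , h with c-∞ j (S-infinite j (wit-refutes j j∈ ¬px)) N
      ... | m , N≤m , ¬k , cm≡j =
        ¬k (subst (λ j′ → M′ ⊨ proj₁ (nth j) [ wit j′ (lift m) ∷ at (lift m) ]) cm≡j (h m N≤m))

      x~y : (M ^ω , x ∷ v) ~[ ps ] (M′ ^ω , y ∷ v′)
      x~y {p} p∈ = mk⇔
        (λ h → ⋀-elim (M′ ^ω , y ∷ v′) A y⊩A (∈-filter⁺ true? p∈ h))
        (λ h → dne λ ¬px → subst Refuted (sym (lookup-index p∈⁺))
          (y-refutes (index p∈⁺) (subst (_∈ᴸ _) (lookup-index p∈⁺) p∈⁺)) ¬px h)
        where
        p∈⁺ : p ∈ᴸ (⊤ₚ List.∷ ps)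
        p∈⁺ = there p∈
        Refuted : Pal (suc n) → Set ℓ
        Refuted q = ¬ M ^ω ⊨ proj₁ q [ x ∷ v ] → ¬ M′ ^ω ⊨ proj₁ q [ y ∷ v′ ]

    -- For a quantifier, `forth` supplies the matching element: from `M` to `M′` for `∃′`, and
    -- backwards for `∀′`. An implication likewise uses the reversed relation for its premise.
    determinedᵒ : (φ : Formula L n) → ∃ (DeterminedByᵒ φ)
    determinedᵒ ⊤′         = List.[] , λ _ _ _ _ _ _ → tt
    determinedᵒ ⊥′         = List.[] , λ _ _ _ _ _ ()
    determinedᵒ (s ≐ t)    = List.[ _ , ≐-pal s t ] , λ _ _ _ _ v~v′ → to (v~v′ (here refl))
    determinedᵒ (rel R ts) = List.[ _ , rel-pal R ts ] , λ _ _ _ _ v~v′ → to (v~v′ (here refl))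
    determinedᵒ (φ ∧′ ψ) with determinedᵒ φ | determinedᵒ ψ
    ... | ps , d | qs , e = ps List.++ qs , λ M M′ v v′ v~v′ (h , k) →
      d M M′ v v′ (v~v′ ∘ ∈-++⁺ˡ) h , e M M′ v v′ (v~v′ ∘ ∈-++⁺ʳ ps) k
    determinedᵒ (φ ∨′ ψ) with determinedᵒ φ | determinedᵒ ψ
    ... | ps , d | qs , e = ps List.++ qs , λ where
      M M′ v v′ v~v′ (inj₁ h) → inj₁ (d M M′ v v′ (v~v′ ∘ ∈-++⁺ˡ) h)
      M M′ v v′ v~v′ (inj₂ k) → inj₂ (e M M′ v v′ (v~v′ ∘ ∈-++⁺ʳ ps) k)
    determinedᵒ (φ ⇒′ ψ) with determinedᵒ φ | determinedᵒ ψ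
    ... | ps , d | qs , e = ps List.++ qs , λ M M′ v v′ v~v′ f h →
      e M M′ v v′ (v~v′ ∘ ∈-++⁺ʳ ps)
        (f (d M′ M v′ v (~-sym {X = M ^ω , v} {M′ ^ω , v′} (v~v′ ∘ ∈-++⁺ˡ)) h))
    determinedᵒ (∃′ φ) with determinedᵒ φ
    ... | ps , d = extensionQueries ps , λ M M′ v v′ v~v′ (x , h) →
      let (y , x~y) = forth ps M M′ v v′ v~v′ x in y , d M M′ _ _ x~y h
    determinedᵒ (∀′ φ) with determinedᵒ φ
    ... | ps , d = extensionQueries ps , λ M M′ v v′ v~v′ h y →
      let (x , y~x) = forth ps M′ M v′ v (~-sym {X = M ^ω , v} {M′ ^ω , v′} v~v′) y
      in  d M M′ _ _ (~-sym {X = M′ ^ω , y ∷ v′} {M ^ω , x ∷ v} y~x) (h x)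

    -- An interpretation and its diagonal agree on `φ` and on all Palyutin formulas, so the result
    -- for powers descends.
    determined : (φ : Formula L n) → Transfers φ → ∃ (DeterminedBy φ)
    determined φ t with determinedᵒ φ
    ... | ps , d = ps , λ X Y X~Y h →
      to (Transfers⇒diagonal φ t Y)
        (d (proj₁ X) (proj₁ Y) (proj₂ (diagonal X)) (proj₂ (diagonal Y))
          (λ {p} p∈ →
            let t′ = Transfers⇒diagonal (proj₁ p) (Palyutin⇒Transfers (proj₂ p)) in mk⇔
              (from (t′ Y) ∘ to (X~Y p∈) ∘ to (t′ X))
              (from (t′ X) ∘ from (X~Y p∈) ∘ to (t′ Y)))
          (from (Transfers⇒diagonal φ t X) h))

    -- Finding an equivalent Palyutin formula

    Transfers⇒Palyutin : (φ : Formula L n) → Transfers φ →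
                         ∃[ ψ ] Palyutin ψ × Equivalent φ ψ
    Transfers⇒Palyutin {n} φ t with dec (Σ[ X ∈ Interp n ] X ⊩ φ)
    ... | no ∄ = ⊥′ , ⊥-pal , λ M v → mk⇔ (λ h → ⊥-elim (∄ ((M , v) , h))) (λ ())
    ... | yes (X , X⊩φ) = proj₁ (⋀ A) , proj₂ (⋀ A) , λ M v → mk⇔ (φ⇒A (M , v)) (A⇒φ (M , v))
      where
      ps = proj₁ (determined φ t)

      -- The chosen `K p` is a model of `φ` that refutes `p` unless `φ` implies `p`.
      ε : (p : Pal n) → _
      ε p = testElement (_⊩ φ) (_⊩ proj₁ p) X

      K : Pal n → Interp n
      K p = proj₁ (ε p)

      K⊩φ : ∀ p → K p ⊩ φ
      K⊩φ p = proj₁ (proj₂ (ε p)) X X⊩φ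

      consequence : ∀ p → K p ⊩ proj₁ p → ∀ Y → Y ⊩ φ → Y ⊩ proj₁ p
      consequence p = proj₂ (proj₂ (ε p))

      consequence? : (p : Pal n) → Dec (K p ⊩ proj₁ p)
      consequence? p = dec _

      A : List (Pal n)
      A = filter consequence? ps

      φ⇒A : ∀ Y → Y ⊩ φ → Y ⊩ proj₁ (⋀ A)
      φ⇒A Y h = ⋀-intro Y A
        (All.map (λ {p} k → consequence p k Y h) (all-filter consequence? ps))

      -- The direct product of `Y`, at index `nothing`, with every `K p`.
      K× : Interp n → Interp n
      K× Y = ∏ nothing (maybe′ K Y)

      K×-transfer : ∀ φ → Transfers φ → ∀ Y →
                    K× Y ⊩ φ ⇔ (∀ i → maybe′ K Y i ⊩ φ)
      K×-transfer φ t Y = Transfers⇒∏ φ t nothing (maybe′ K Y)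

      -- The factor `K p` spoils each `p` that `φ` does not imply. If `φ` implies `p`, then `Y`
      -- satisfies it through `A` and the other factors satisfy it as models of `φ`. Hence the truth
      -- values on `ps` do not depend on `Y`.
      K×-type : ∀ Y → Y ⊩ proj₁ (⋀ A) → ∀ {p} → p ∈ᴸ ps →
                K× Y ⊩ proj₁ p ⇔ K p ⊩ proj₁ p
      K×-type Y h {p} p∈ = mk⇔
        (λ k → to p-transfer k (just p))
        (λ k → from p-transfer λ where
          nothing  → ⋀-elim Y A h (∈-filter⁺ consequence? p∈ k)
          (just q) → consequence p k (K q) (K⊩φ q))
        where
        p-transfer = K×-transfer (proj₁ p) (Palyutin⇒Transfers (proj₂ p)) Y

      A⇒φ : ∀ Y → Y ⊩ proj₁ (⋀ A) → Y ⊩ φ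
      -- `K× X` is a product of models of `φ`, hence a model of `φ`. `K× Y` agrees with it on `ps`,
      -- so it is one too, and then so is its factor `Y`.
      A⇒φ Y h = to (K×-transfer φ t Y)
        (proj₂ (determined φ t) (K× X) (K× Y)
          (λ p∈ → let e = K×-type X (φ⇒A X X⊩φ) p∈
                      f = K×-type Y h p∈
                  in  mk⇔ (from f ∘ to e) (from e ∘ to f))
          (from (K×-transfer φ t X) λ { nothing → X⊩φ ; (just q) → K⊩φ q }))
        nothing

    -- Free variables as new constants

    module _ {n : ℕ} (M : Structure (L ⟨ n ⟩)) where

      eval-nameᵗ : ∀ k (w : Vector ∣ M ∣ k) (t : Term L (k ℕ.+ n)) →
        eval M w (nameᵗ k t) ≡ eval (reduct M) (w ++ constants M) t
      eval-nameᵗ k w (var x) with splitAt k x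
      ... | inj₁ _ = refl
      ... | inj₂ c = cong (Structure.⟦_⟧ᶠ M (inj₂ c)) (ext λ ())
      eval-nameᵗ k w (func f ts) =
        cong (Structure.⟦_⟧ᶠ M (inj₁ f)) (ext λ j → eval-nameᵗ k w (ts j))

      ++-∷ : ∀ k (x : ∣ M ∣) (w : Vector ∣ M ∣ k) →
             (x ∷ w) ++ constants M ≡ x ∷ (w ++ constants M)
      ++-∷ k x w = ext pointwise
        where
        pointwise : ∀ i → ((x ∷ w) ++ constants M) i ≡ (x ∷ (w ++ constants M)) i
        pointwise Fin.zero = refl
        pointwise (Fin.suc i) with splitAt k i
        ... | inj₁ _ = refl
        ... | inj₂ _ = refl

      -- Stated as an equality of types, so that connectives and quantifiers are handled by
      -- congruence and extensionality.
      ⊨-name : ∀ k (w : Vector ∣ M ∣ k) (φ : Formula L (k ℕ.+ n)) →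
        (M ⊨ name k φ [ w ]) ≡ (reduct M ⊨ φ [ w ++ constants M ])

      ⊨-name-∷ : ∀ k (w : Vector ∣ M ∣ k) (φ : Formula L (suc k ℕ.+ n)) x →
        (M ⊨ name (suc k) φ [ x ∷ w ]) ≡ (reduct M ⊨ φ [ x ∷ (w ++ constants M) ])
      ⊨-name-∷ k w φ x =
        trans (⊨-name (suc k) (x ∷ w) φ) (cong (reduct M ⊨ φ [_]) (++-∷ k x w))

      ⊨-name k w ⊤′         = refl
      ⊨-name k w ⊥′         = refl
      ⊨-name k w (s ≐ t)    =
        cong₂ (Structure._≈_ M) (eval-nameᵗ k w s) (eval-nameᵗ k w t)
      ⊨-name k w (rel R ts) =
        cong (Structure.⟦_⟧ᴿ M R) (ext λ j → eval-nameᵗ k w (ts j))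
      ⊨-name k w (φ ∧′ ψ)   = cong₂ _×_ (⊨-name k w φ) (⊨-name k w ψ)
      ⊨-name k w (φ ∨′ ψ)   = cong₂ _⊎_ (⊨-name k w φ) (⊨-name k w ψ)
      ⊨-name k w (φ ⇒′ ψ)   = cong₂ (λ A B → A → B) (⊨-name k w φ) (⊨-name k w ψ)
      ⊨-name k w (∃′ φ)     = cong ∃ (ext (⊨-name-∷ k w φ))
      ⊨-name k w (∀′ φ)     = cong (λ P → ∀ x → P x) (ext (⊨-name-∷ k w φ))

      ⊨ᵀ-asTheory : (φ : Formula L n) →
                    M ⊨ᵀ asTheory φ ⇔ reduct M ⊨ φ [ constants M ]
      ⊨ᵀ-asTheory φ = mk⇔
        (λ h → to e (h _ refl))
        (λ { h _ refl → from e h })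
        where e = ≡⇒⇔ (⊨-name 0 [] φ)

    -- Bipreservation as transfer

    Bipreserved⇒Transfers : (φ : Formula L n) → Bipreserved φ → Transfers φ
    Bipreserved⇒Transfers φ (preserved , copreserved) I M F v = mk⇔
      (λ h → upward (λ {i} → to (⊨ᵀ-asTheory (N i) φ))
               (copreserved I N F (from (⊨ᵀ-asTheory (reducedProduct N F) φ) h)))
      (λ h → to (⊨ᵀ-asTheory (reducedProduct N F) φ)
               (preserved I N F (upward (λ {i} → from (⊨ᵀ-asTheory (N i) φ)) h)))
      where
      open Filter F
      -- The new constants name the coordinates of `v`; the reduct of the reduced product of `N`
      -- gives back that of `M`, and the constants give back `v`, by computation.
      N : I → Structure (L ⟨ _ ⟩)
      N i = expand (M i) (λ x → v x i)

    -- Both sides apply a nullary symbol to an empty vector, but the two vectors are equal only by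
    -- extensionality.
    constants-reducedProduct : {I : Set ℓ} (M : I → Structure (L ⟨ n ⟩)) (F : Filter I) →
      constants (reducedProduct M F) ≡ λ x i → constants (M i) x
    constants-reducedProduct M F =
      ext λ x → ext λ i → cong (Structure.⟦_⟧ᶠ (M i) (inj₂ x)) (ext λ ())

    Transfers⇒Bipreserved : (φ : Formula L n) → Transfers φ → Bipreserved φ
    Transfers⇒Bipreserved {n} φ t =
      (λ I M F h → from (⊨ᵀ-asTheory (reducedProduct M F) φ)
        (from (transfer I M F) (Filter.upward F (λ {i} → to (⊨ᵀ-asTheory (M i) φ)) h))) ,
      (λ I M F h → Filter.upward F (λ {i} → from (⊨ᵀ-asTheory (M i) φ))
        (to (transfer I M F) (to (⊨ᵀ-asTheory (reducedProduct M F) φ) h)))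
      where
      transfer : (I : Set ℓ) (M : I → Structure (L ⟨ n ⟩)) (F : Filter I) →
        reduct (reducedProduct M F) ⊨ φ [ constants (reducedProduct M F) ] ⇔
        (λ i → reduct (M i) ⊨ φ [ constants (M i) ]) ∈ Filter.sets F
      transfer I M F =
        subst (λ v → reduct (reducedProduct M F) ⊨ φ [ v ] ⇔
                     (λ i → reduct (M i) ⊨ φ [ constants (M i) ]) ∈ Filter.sets F)
              (sym (constants-reducedProduct M F))
              (t I (reduct ∘ M) F (λ x i → constants (M i) x))

corollary1p18 : (∀ a → ExcludedMiddle a) →
    (∀ a b → Extensionality a b) →
    (ℓ : Level) (L : Signature ℓ) (n : ℕ) (φ : Formula L n) →
    Bipreserved φ ⇔ ∃ (λ (ψ : Formula L n) → Palyutin ψ × Equivalent φ ψ)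
corollary1p18 em fe ℓ L n φ = mk⇔
  (λ bi → Transfers⇒Palyutin φ (Bipreserved⇒Transfers φ bi))
  (λ (ψ , pal , φ⇔ψ) →
    Transfers⇒Bipreserved φ (Transfers-resp φ ψ φ⇔ψ (Palyutin⇒Transfers pal)))
  where open Classical em fe
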